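{- There exists a subset of $2^\omega$ with the Grinzing property.
   Context: A subset $W$ of $2^\omega$ has the Grinzing property if $W$ is uncountable and for every uncountable $Y\subseteq W$ there exist uncountable subsets $Y_\alpha$ of $Y$, for $\alpha\in\omega_1$, such that $\mathrm{cl}(Y_\alpha)\cap\mathrm{cl}(Y_\beta)=\varnothing$ whenever $\alpha\neq\beta$, where the closure is taken in $2^\omega$. The result is a theorem of $\mathsf{ZFC}$. -}

module Defs where

open import Data.Bool using (Bool; T)
open import Data.Nat using (ℕ; _<_)
open import Data.Product using (Σ-syntax; ∃-syntax; _×_; _,_; proj₁; proj₂)
open import Function.Base using (id; _∘_)
open import Function.Bundles using (Func; Injection)
open import Induction.WellFounded using (WellFounded)
open import Level using (0ℓ) renaming (suc to lsuc)
open import Relation.Binary.Bundles using (Setoid)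
open import Relation.Binary.Core using (REL)
open import Relation.Binary.Definitions using (_Respectsˡ_; _Respectsʳ_; _Respects_)
import Relation.Binary.Construct.On as On
open import Relation.Binary.Morphism.Structures using (IsOrderIsomorphism)
import Relation.Binary.Morphism.Construct.Composition as CompM
import Relation.Binary.Morphism.Construct.Identity as IdM
open import Relation.Binary.PropositionalEquality
  using (_≡_; refl; sym; trans; cong; subst₂; setoid; _→-setoid_)
open import Relation.Binary.Structures using (IsStrictTotalOrder)
open import Relation.Nullary using (¬_)
open import Relation.Unary using (Pred; _∈_; _⊆_; _⊥_; _≐_)
open import Relation.Unary.Properties using (≐-refl; ≐-sym; ≐-trans)

-- Choice for setoids: the choice function must respect equality. The version
-- without that requirement is provable in type theory; this one has the
-- strength of the axiom of choice of ZFC.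
AxiomOfChoice : ∀ ℓ → Set (lsuc ℓ)
AxiomOfChoice ℓ =
  (A B : Setoid ℓ ℓ) → let module A = Setoid A ; module B = Setoid B in
  (R : REL A.Carrier B.Carrier ℓ) → R Respectsˡ A._≈_ → R Respectsʳ B._≈_ →
  (∀ x → ∃[ y ] R x y) →
  Σ[ f ∈ Func A B ] (∀ x → R x (Func.to f x))

-- 2^ω, with pointwise equality.
Cantor : Setoid 0ℓ 0ℓ
Cantor = ℕ →-setoid Bool

Point : Set
Point = Setoid.Carrier Cantor

record Subset : Set₁ where
  field
    member   : Pred Point 0ℓ
    respects : member Respects (Setoid._≈_ Cantor)

open Subset public

subsets : Setoid (lsuc 0ℓ) 0ℓ
subsets = record
  { Carrier       = Subset
  ; _≈_           = λ A B → member A ≐ member B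
  ; isEquivalence = record { refl = ≐-refl ; sym = ≐-sym ; trans = ≐-trans }
  }

asSetoid : Subset → Setoid 0ℓ 0ℓ
asSetoid A = On.setoid Cantor (proj₁ {B = member A})

Countable : Setoid 0ℓ 0ℓ → Set
Countable S = Injection S (setoid ℕ)

Uncountable : Subset → Set
Uncountable A = ¬ Countable (asSetoid A)

-- The sets { y | y agrees with x below n } form a neighbourhood base at x
-- in the product topology.
cl : Subset → Pred Point 0ℓ
cl A x = ∀ n → ∃[ y ] y ∈ member A × (∀ i → i < n → y i ≡ x i)

-- A well-order on a subset of ℕ; values of lt outside dom are irrelevant.
record CountableWellOrder : Set where
  field
    dom : ℕ → Bool
    lt  : ℕ → ℕ → Bool

  El : Set
  El = Σ[ n ∈ ℕ ] T (dom n)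

  _≺_ : El → El → Set
  a ≺ b = T (lt (proj₁ a) (proj₁ b))

  field
    isStrictTotalOrder : IsStrictTotalOrder _≡_ _≺_
    wellFounded        : WellFounded _≺_

open CountableWellOrder using (El)

_≅_ : CountableWellOrder → CountableWellOrder → Set
α ≅ β = Σ[ f ∈ (El α → El β) ] IsOrderIsomorphism _≡_ _≡_ α._≺_ β._≺_ f
  where
  module α = CountableWellOrder α
  module β = CountableWellOrder β

≅-refl : ∀ {α} → α ≅ α
≅-refl {α} = id , IdM.isOrderIsomorphism _≡_ (CountableWellOrder._≺_ α) refl

≅-sym : ∀ {α β} → α ≅ β → β ≅ α
≅-sym {α} {β} (f , iso) = g , record
  { isOrderMonomorphism = record
    { isOrderHomomorphism = record
      { cong = cong g
      ; mono = λ {x} {y} x≺y →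
          I.cancel (subst₂ β._≺_ (sym (fg x)) (sym (fg y)) x≺y)
      }
    ; injective = λ {x} {y} e → trans (sym (fg x)) (trans (cong f e) (fg y))
    ; cancel    = λ {x} {y} gx≺gy → subst₂ β._≺_ (fg x) (fg y) (I.mono gx≺gy)
    }
  ; surjective = λ x → f x , λ { refl → I.injective (fg (f x)) }
  }
  where
  module I = IsOrderIsomorphism iso
  module β = CountableWellOrder β
  g : El β → El α
  g y = proj₁ (I.surjective y)
  fg : ∀ y → f (g y) ≡ y
  fg y = proj₂ (I.surjective y) refl

≅-trans : ∀ {α β γ} → α ≅ β → β ≅ γ → α ≅ γ
≅-trans (f , i) (g , j) = g ∘ f , CompM.isOrderIsomorphism trans i j

-- ω₁ is the set of countable ordinals, and a countable ordinal is the
-- isomorphism type of a well-order on a subset of ℕ.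
ω₁ : Setoid 0ℓ 0ℓ
ω₁ = record
  { Carrier       = CountableWellOrder
  ; _≈_           = _≅_
  ; isEquivalence = record { refl = λ {α} → ≅-refl {α}
                           ; sym = λ {α} {β} → ≅-sym {α} {β}
                           ; trans = λ {α} {β} {γ} → ≅-trans {α} {β} {γ} }
  }

Grinzing : Subset → Set₁
Grinzing W =
  Uncountable W ×
  (∀ (Y : Subset) → member Y ⊆ member W → Uncountable Y →
    Σ[ F ∈ Func ω₁ subsets ] let open Func F renaming (to to Y[_]) in
      (∀ α → member Y[ α ] ⊆ member Y × Uncountable Y[ α ]) ×
      (∀ α β → ¬ α ≅ β → cl Y[ α ] ⊥ cl Y[ β ]))

{-# OPTIONS --safe #-}

-- Write (y)ₙ for the n-th column of a real y, read through a pairing of ℕ.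
-- By transfinite recursion choose reals w_α, α < ω₁, such that w_α differs from
-- every earlier w_β and has every earlier w_β among its columns; W is the set
-- of all w_α. Let Y ⊆ W be uncountable. For x ∈ Y, all but countably many
-- y ∈ Y have x as a column, so for some n the set { y ∈ Y | (y)ₙ = x } is
-- uncountable, and one n serves an uncountable set X of points x. As y ↦ (y)ₙ
-- is continuous, these sets have disjoint closures for distinct x, and it
-- remains to index them by an injection of ω₁ into X, found by the same
-- recursion.
module Submission where

open import Defs
open import Axiom.ExcludedMiddle using (ExcludedMiddle)
open import Data.Bool using (T; T?; false; not)
open import Data.Bool.Properties using (T-irrelevant; not-¬)
open import Data.Empty using (⊥)
open import Data.Nat using (ℕ; zero; suc; _+_)
open import Data.Nat.Properties using (+-suc; +-identityʳ; n<1+n)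
open import Data.Product using (Σ-syntax; ∃-syntax; _×_; _,_; proj₁; proj₂)
open import Data.Sum using (_⊎_; inj₁; inj₂)
open import Data.Unit using (⊤; tt)
open import Function.Base using (id; _∘_; const)
open import Function.Bundles using (Func; Injection)
open import Induction.WellFounded using (Acc; acc; WellFounded)
open import Level using (0ℓ)
open import Relation.Binary.Bundles using (Setoid)
open import Relation.Binary.Definitions using (_Respects_; tri<; tri≈; tri>)
open import Relation.Binary.Morphism.Structures using (IsOrderIsomorphism)
open import Relation.Binary.PropositionalEquality
  using (_≡_; refl; sym; trans; cong; subst; setoid)
open import Relation.Binary.Structures using (IsStrictTotalOrder)
open import Relation.Nullary using (¬_; Dec; yes; no; contradiction; _×-dec_; decidable-stable)
open import Relation.Unary using (Pred; _∈_; _⊆_)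

open CountableWellOrder using (El)
open Setoid Cantor using (_≈_) renaming (refl to ≈-refl)

≈-sym : ∀ {x y : Point} → x ≈ y → y ≈ x
≈-sym p n = sym (p n)

≈-trans : ∀ {x y z : Point} → x ≈ y → y ≈ z → x ≈ z
≈-trans p q n = trans (p n) (q n)

-- Pairing of natural numbers and columns of a real.

-- The unpairing runs through each antidiagonal of ℕ × ℕ in turn.
next : ℕ × ℕ → ℕ × ℕ
next (zero  , b) = suc b , zero
next (suc a , b) = a , suc b

unpair : ℕ → ℕ × ℕ
unpair zero    = zero , zero
unpair (suc k) = next (unpair k)

-- Each `next` inside an antidiagonal lowers the first coordinate and raises the second, so
-- `(a , b)` comes `b` steps after the axis point `(b + a , 0)`.
unpair-along : ∀ a b → ∃[ k ] unpair k ≡ (b + a , 0) → ∃[ k ] unpair k ≡ (a , b)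
unpair-along a zero    start = start
unpair-along a (suc b) start
  with k , e ← unpair-along (suc a) b
                 (subst (λ c → ∃[ k ] unpair k ≡ (c , 0)) (sym (+-suc b a)) start)
  = suc k , cong next e

unpair-axis : ∀ a → ∃[ k ] unpair k ≡ (a , 0)
unpair-axis zero    = zero , refl
unpair-axis (suc a)
  with k , e ← unpair-along 0 a
                 (subst (λ c → ∃[ k ] unpair k ≡ (c , 0)) (sym (+-identityʳ a)) (unpair-axis a))
  -- The axis point `(suc a , 0)` follows `(0 , a)`, the end of the previous antidiagonal.
  = suc k , cong next e

unpair-surjective : ∀ a b → ∃[ k ] unpair k ≡ (a , b)
unpair-surjective a b = unpair-along a b (unpair-axis (b + a))

pair : ℕ → ℕ → ℕ
pair a b = proj₁ (unpair-surjective a b)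

unpair-pair : ∀ a b → unpair (pair a b) ≡ (a , b)
unpair-pair a b = proj₂ (unpair-surjective a b)

column : ℕ → Point → Point
column n x k = x (pair n k)

column-cong : ∀ n {x y} → x ≈ y → column n x ≈ column n y
column-cong n p k = p (pair n k)

-- Sequences of reals and the sets they cover.

infix 4 _∈ran_ _⊆ran_

_∈ran_ : Point → (ℕ → Point) → Set
x ∈ran u = ∃[ n ] u n ≈ x

_⊆ran_ : (ℕ → Point) → (ℕ → Point) → Set
u ⊆ran v = ∀ n → u n ∈ran v

∈ran-resp : ∀ u {x y} → x ≈ y → x ∈ran u → y ∈ran u
∈ran-resp u x≈y (n , p) = n , ≈-trans p x≈y

∈-⊆ran : ∀ {u v x} → x ∈ran u → u ⊆ran v → x ∈ran v
∈-⊆ran {v = v} (n , p) u⊆v = ∈ran-resp v p (u⊆v n)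

⋃ran : (ℕ → ℕ → Point) → ℕ → Point
⋃ran u n = u (proj₁ (unpair n)) (proj₂ (unpair n))

∈-⋃ran : ∀ u i {x} → x ∈ran u i → x ∈ran ⋃ran u
∈-⋃ran u i (n , p) = pair i n , subst (λ q → u (proj₁ q) (proj₂ q) ≈ _) (sym (unpair-pair i n)) p

-- Sequences are identified when they have the same range, so a choice function on this setoid
-- depends only on the countable set enumerated.
sequences : Setoid 0ℓ 0ℓ
sequences = record
  { Carrier       = ℕ → Point
  ; _≈_           = λ u v → u ⊆ran v × v ⊆ran u
  ; isEquivalence = record
    { refl  = (λ n → n , ≈-refl) , (λ n → n , ≈-refl)
    ; sym   = λ (p , q) → q , p
    ; trans = λ (p , q) (p′ , q′) → (λ n → ∈-⊆ran (p n) p′) , (λ n → ∈-⊆ran (q′ n) q)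
    }
  }

-- Countability as a covering: `u` may also hit points outside `P`, so the empty set is no special
-- case and subsets inherit the same `u`.
Small : Pred Point 0ℓ → Set
Small P = ∃[ u ] (∀ {x} → x ∈ P → x ∈ran u)

Small-⊆ : ∀ {P Q : Pred Point 0ℓ} → P ⊆ Q → Small Q → Small P
Small-⊆ P⊆Q (u , cover) = u , λ x∈P → cover (P⊆Q x∈P)

Small-⋃ : ∀ {P : ℕ → Pred Point 0ℓ} → (∀ n → Small (P n)) → Small (λ x → ∃[ n ] x ∈ P n)
Small-⋃ small =
  ⋃ran (proj₁ ∘ small) , λ (n , x∈P) → ∈-⋃ran (proj₁ ∘ small) n (proj₂ (small n) x∈P)

Small-∪ : ∀ {P Q : Pred Point 0ℓ} → Small P → Small Q → Small (λ x → x ∈ P ⊎ x ∈ Q)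
Small-∪ {P} {Q} p q = Small-⊆ (λ { (inj₁ x∈P) → 0 , x∈P ; (inj₂ x∈Q) → 1 , x∈Q }) (Small-⋃ small)
  where
  piece : ℕ → Pred Point 0ℓ
  piece zero    = P
  piece (suc _) = Q
  small : ∀ n → Small (piece n)
  small zero    = p
  small (suc _) = q

-- Countable ordinals as Brouwer trees.

-- Brouwer trees; sup s denotes the least ordinal above all s n.
data Ord : Set where
  zero : Ord
  sup  : (ℕ → Ord) → Ord

infix 4 _≤_ _<_

-- Many trees denote one ordinal; `a ≤ b` together with `b ≤ a` plays the role of equality.
_≤_ _<_ : Ord → Ord → Set
zero  ≤ b = ⊤
sup s ≤ b = ∀ i → s i < b
a < zero  = ⊥
a < sup t = ∃[ j ] a ≤ t j

≤-refl : ∀ a → a ≤ a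
≤-refl zero    = tt
≤-refl (sup s) = λ i → i , ≤-refl (s i)

≤-trans   : ∀ a b c → a ≤ b → b ≤ c → a ≤ c
<-≤-trans : ∀ a b c → a < b → b ≤ c → a < c
≤-<-trans : ∀ a b c → a ≤ b → b < c → a < c
≤-trans zero    b c p q = tt
≤-trans (sup s) b c p q = λ i → <-≤-trans (s i) b c (p i) q
<-≤-trans a (sup t) c (j , p) q = ≤-<-trans a (t j) c p (q j)
≤-<-trans a b (sup t) p (k , q) = k , ≤-trans a b (t k) p q

<⇒≤ : ∀ a b → a < b → a ≤ b
<⇒≤ zero    b       p       = tt
<⇒≤ (sup s) (sup t) (j , p) = λ i → j , <⇒≤ (s i) (t j) (p i)

<-trans : ∀ a b c → a < b → b < c → a < c
<-trans a b c p q = <-≤-trans a b c p (<⇒≤ b c q)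

<-irrefl : ∀ a → ¬ a < a
<-irrefl (sup t) (j , p) = <-irrefl (t j) (p j)

<-acc : ∀ {a b} → a ≤ b → Acc _<_ b → Acc _<_ a
<-acc {a} {b} p (acc h) = acc λ {c} q → h (<-≤-trans c a b q p)

<-wellFounded : WellFounded _<_
<-wellFounded zero    = acc λ ()
<-wellFounded (sup s) = acc λ (j , p) → <-acc p (<-wellFounded (s j))

when : ∀ {P : Set} → Dec P → (P → Ord) → Ord
when (yes p) k = k p
when (no  _) k = zero

≤-when : ∀ {P : Set} (d : Dec P) k {a} → P → (∀ p → a ≤ k p) → a ≤ when d k
≤-when (yes p) k _ h = h p
≤-when (no ¬p) k p h = contradiction p ¬p

when-< : ∀ {P : Set} (d : Dec P) k {b} → zero < b → (∀ p → k p < b) → when d k < b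
when-< (yes p) k _ h = h p
when-< (no  _) k z h = z

≤-when⁻ : ∀ {P : Set} (d : Dec P) k {a} → zero < a → a ≤ when d k → ∃[ p ] a ≤ k p
≤-when⁻ (yes p) k     z h = p , h
≤-when⁻ (no  _) k {a} z h = contradiction (<-≤-trans zero a zero z h) λ ()

-- Ranks of countable well-orders.

module _ (α : CountableWellOrder) where
  open CountableWellOrder α using (dom; lt; _≺_; wellFounded)

  below? : ∀ (a : El α) n → Dec (Σ[ d ∈ T (dom n) ] (n , d) ≺ a)
  below? a n = T? (dom n) ×-dec T? (lt n (proj₁ a))

  -- Indices that are not below `a` contribute the default `zero`. A minimal element therefore gets
  -- rank 1, and all ranks are positive, which separates genuine predecessors from defaults.
  rankAcc : ∀ a → Acc _≺_ a → Ord
  rankAcc a (acc h) = sup λ n → when (below? a n) λ (d , l) → rankAcc (n , d) (h l)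

  rankEl : El α → Ord
  rankEl a = rankAcc a (wellFounded a)

  -- In effect this is 1 + the order type of `α`.
  rank : Ord
  rank = sup λ n → when (T? (dom n)) λ d → rankEl (n , d)

  El-≡ : ∀ {a b : El α} → proj₁ a ≡ proj₁ b → a ≡ b
  El-≡ {n , d} {_ , d′} refl = cong (n ,_) (T-irrelevant d d′)

  rankAcc-positive : ∀ a p → zero < rankAcc a p
  rankAcc-positive a (acc _) = 0 , tt

  rankEl-positive : ∀ a → zero < rankEl a
  rankEl-positive a = rankAcc-positive a (wellFounded a)

module _ {α β : CountableWellOrder} where
  private
    module α = CountableWellOrder α
    module β = CountableWellOrder β

  -- A monotone map sends predecessors of `a` to predecessors of `b`. With `f = id` this shows that
  -- the rank does not depend on the accessibility proof. The equation `f a ≡ b` leaves room for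
  -- elements rebuilt with another proof of membership in the domain.
  rankAcc-mono : ∀ (f : El α → El β) → (∀ {a b} → a α.≺ b → f a β.≺ f b) →
                 ∀ a b → f a ≡ b → ∀ p q → rankAcc α a p ≤ rankAcc β b q
  rankAcc-mono f mono a b refl (acc p) (acc q) n =
    when-< (below? α a n) _ (0 , tt) λ (d , l) →
      proj₁ (f (n , d)) ,
      ≤-when (below? β (f a) _) _ (proj₂ (f (n , d)) , mono l) λ (d′ , l′) →
        rankAcc-mono f mono (n , d) (_ , d′) (El-≡ β refl) (p l) (q l′)

  rankEl-mono : ∀ (f : El α → El β) → (∀ {a b} → a α.≺ b → f a β.≺ f b) →
                ∀ a b → f a ≡ b → rankEl α a ≤ rankEl β b
  rankEl-mono f mono a b e = rankAcc-mono f mono a b e (α.wellFounded a) (β.wellFounded b)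

module _ (α : CountableWellOrder) where
  open CountableWellOrder α using (dom; _≺_; wellFounded; isStrictTotalOrder)
  open IsStrictTotalOrder isStrictTotalOrder using (compare)

  rankEl-≺ : ∀ {a b} → a ≺ b → rankEl α a < rankEl α b
  rankEl-≺ {a} {b} a≺b = go (wellFounded b)
    where
    go : ∀ p → rankEl α a < rankAcc α b p
    go (acc h) = proj₁ a , ≤-when (below? α b (proj₁ a)) _ (proj₂ a , a≺b) λ (d , l) →
      rankAcc-mono {α} {α} id id a (_ , d) (El-≡ α refl) (wellFounded a) (h l)

  rankEl<rank : ∀ a → rankEl α a < rank α
  rankEl<rank a = proj₁ a , ≤-when (T? (dom (proj₁ a))) _ (proj₂ a) λ d →
    rankEl-mono {α} {α} id id a (_ , d) (El-≡ α refl)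

  rankEl-≺⁻ : ∀ a b → rankEl α a < rankEl α b → a ≺ b
  rankEl-≺⁻ a b p with compare a b
  ... | tri< a≺b _    _   = a≺b
  ... | tri≈ _   refl _   = contradiction p (<-irrefl (rankEl α a))
  ... | tri> _   _    b≺a = contradiction (<-trans (rankEl α a) (rankEl α b) _ p (rankEl-≺ b≺a))
                                          (<-irrefl (rankEl α a))

  rankEl-injective : ∀ a b → rankEl α a ≤ rankEl α b → rankEl α b ≤ rankEl α a → a ≡ b
  rankEl-injective a b p q with compare a b
  ... | tri< a≺b _    _   =
    contradiction (<-≤-trans (rankEl α a) (rankEl α b) _ (rankEl-≺ a≺b) q) (<-irrefl (rankEl α a))
  ... | tri≈ _   a≡b  _   = a≡b
  ... | tri> _   _    b≺a =
    contradiction (<-≤-trans (rankEl α b) (rankEl α a) _ (rankEl-≺ b≺a) p) (<-irrefl (rankEl α b))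

  -- Some term of the supremum reaches `o`; being positive, `o` cannot lie below a default term, so
  -- that term is the rank of a predecessor.
  <rankEl : ∀ {o} → zero < o → ∀ b → o < rankEl α b → ∃[ c ] c ≺ b × o ≤ rankEl α c
  <rankEl {o} z b = go (wellFounded b)
    where
    go : ∀ p → o < rankAcc α b p → ∃[ c ] c ≺ b × o ≤ rankEl α c
    go (acc h) (n , p) with (d , l) , q ← ≤-when⁻ (below? α b n) _ z p =
      (n , d) , l , ≤-trans o (rankAcc α (n , d) (h l)) _ q
        (rankAcc-mono {α} {α} id id (n , d) (n , d) refl (h l) (wellFounded (n , d)))

  <rank : ∀ {o} → zero < o → o < rank α → ∃[ c ] o ≤ rankEl α c
  <rank z (n , p) with d , q ← ≤-when⁻ (T? (dom n)) _ z p = (n , d) , q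

rank-mono : ∀ {α β} → α ≅ β → rank α ≤ rank β
rank-mono {α} {β} (f , iso) n = when-< (T? (dom α n)) _ (0 , tt) λ d →
  ≤-<-trans (rankEl α (n , d)) _ (rank β)
    (rankEl-mono {α} {β} f I.mono (n , d) _ refl) (rankEl<rank β (f (n , d)))
  where
  open CountableWellOrder using (dom)
  module I = IsOrderIsomorphism iso

-- Classical comparison of ordinals, ranks and sizes.

module _ (em : ExcludedMiddle 0ℓ) where

  ∀⊎∃¬ : ∀ (P : ℕ → Set) → (∀ n → P n) ⊎ ∃[ n ] ¬ P n
  ∀⊎∃¬ P with em {∃[ n ] ¬ P n}
  ... | yes p = inj₂ p
  ... | no ¬p = inj₁ λ n → decidable-stable em λ ¬Pn → ¬p (n , ¬Pn)

  ≤-<-connex : ∀ a b → a ≤ b ⊎ b < a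
  ≤-<-connex zero    b = inj₁ tt
  ≤-<-connex (sup s) b with em {∃[ i ] b ≤ s i}
  ... | yes p = inj₂ p
  ... | no ¬p = inj₁ λ i → case-≤ i (≤-<-connex b (s i))
    where
    case-≤ : ∀ i → b ≤ s i ⊎ s i < b → s i < b
    case-≤ i (inj₁ p) = contradiction (i , p) ¬p
    case-≤ i (inj₂ q) = q

  -- Start at an element of rank at least `o` and step down while the rank exceeds `o`;
  -- well-foundedness ends the descent at rank exactly `o`.
  rank-attained : ∀ α {o} → zero < o → o < rank α → ∃[ a ] o ≤ rankEl α a × rankEl α a ≤ o
  rank-attained α {o} z o<α with c , o≤c ← <rank α z o<α = go c (wellFounded c) o≤c
    where
    open CountableWellOrder α using (_≺_; wellFounded)
    go : ∀ c → Acc _≺_ c → o ≤ rankEl α c → ∃[ a ] o ≤ rankEl α a × rankEl α a ≤ o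
    go c (acc h) p with ≤-<-connex (rankEl α c) o
    ... | inj₁ q = c , p , q
    ... | inj₂ q with e , e≺c , r ← <rankEl α z c q = go e (h e≺c) r

  -- The isomorphism matches elements of equal rank: partners exist by `rank-attained`, and an
  -- element is determined by its rank.
  rank-injective : ∀ α β → rank α ≤ rank β → rank β ≤ rank α → α ≅ β
  rank-injective α β α≤β β≤α = f , record
    { isOrderMonomorphism = record
      { isOrderHomomorphism = record
        { cong = cong f
        ; mono = λ {a} {b} a≺b → rankEl-≺⁻ β (f a) (f b)
            (≤-<-trans (rβ (f a)) (rα a) _ (f≤ a)
              (<-≤-trans (rα a) (rα b) _ (rankEl-≺ α a≺b) (≤f b)))
        }
      ; injective = λ {a} {b} e → rankEl-injective α a b (f-cancel e) (f-cancel (sym e))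
      ; cancel    = λ {a} {b} fa≺fb → rankEl-≺⁻ α a b
          (≤-<-trans (rα a) (rβ (f a)) _ (≤f a)
            (<-≤-trans (rβ (f a)) (rβ (f b)) _ (rankEl-≺ β fa≺fb) (f≤ b)))
      }
    ; surjective = λ b → let a , b≤a , a≤b = from b in a , λ { refl →
        rankEl-injective β (f a) b
          (≤-trans (rβ (f a)) (rα a) _ (f≤ a) a≤b)
          (≤-trans (rβ b) (rα a) _ b≤a (≤f a)) }
    }
    where
    rα = rankEl α
    rβ = rankEl β
    to : ∀ a → ∃[ b ] rα a ≤ rβ b × rβ b ≤ rα a
    to a = rank-attained β (rankEl-positive α a)
             (<-≤-trans (rα a) (rank α) (rank β) (rankEl<rank α a) α≤β)
    from : ∀ b → ∃[ a ] rβ b ≤ rα a × rα a ≤ rβ b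
    from b = rank-attained α (rankEl-positive β b)
               (<-≤-trans (rβ b) (rank β) (rank α) (rankEl<rank β b) β≤α)
    f : El α → El β
    f = proj₁ ∘ to
    ≤f : ∀ a → rα a ≤ rβ (f a)
    ≤f = proj₁ ∘ proj₂ ∘ to
    f≤ : ∀ a → rβ (f a) ≤ rα a
    f≤ = proj₂ ∘ proj₂ ∘ to
    f-cancel : ∀ {a b} → f a ≡ f b → rα a ≤ rα b
    f-cancel {a} {b} e =
      ≤-trans (rα a) (rβ (f a)) _ (≤f a) (subst (λ c → rβ c ≤ rα b) (sym e) (f≤ b))

  -- A point may occur in `u` at many indices. Choice for setoids selects one in a way that respects
  -- pointwise equality, and the index determines the point.
  Uncountable⇒¬Small : AxiomOfChoice 0ℓ → ∀ A → Uncountable A → ¬ Small (member A)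
  Uncountable⇒¬Small ac A unc (u , cover) = unc record
    { to        = Func.to index
    ; cong      = λ {x} {y} → Func.cong index {x} {y}
    ; injective = λ {x} {y} e → ≈-trans (≈-sym (hit x)) (subst (λ n → u n ≈ proj₁ y) (sym e) (hit y))
    }
    where
    choice = ac (asSetoid A) (setoid ℕ) (λ x n → u n ≈ proj₁ x)
      (λ x≈y p → ≈-trans p x≈y) (λ { refl p → p }) (λ (_ , x∈A) → cover x∈A)
    index = proj₁ choice
    hit   = proj₂ choice

  ¬Small⇒Uncountable : ∀ A → ¬ Small (member A) → Uncountable A
  ¬Small⇒Uncountable A ¬small j = ¬small (u , cover)
    where
    module J = Injection j
    pick : ∀ {n} → Dec (∃[ x ] J.to x ≡ n) → Point
    pick (yes (x , _)) = proj₁ x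
    pick (no  _)       = const false
    u : ℕ → Point
    u n = pick {n} em
    cover : ∀ {x} → x ∈ member A → x ∈ran u
    cover {x} x∈A = J.to (x , x∈A) , hit em
      where
      hit : (d : Dec (∃[ y ] J.to y ≡ J.to (x , x∈A))) → pick d ≈ x
      hit (yes (_ , e)) = J.injective e
      hit (no ¬p)       = contradiction ((x , x∈A) , refl) ¬p

  -- Transfinite recursion along Brouwer trees.

  module Recursion (ac : AxiomOfChoice 0ℓ) (R : (ℕ → Point) → Point → Set)
    (resp-ran : ∀ {u v y} → u ⊆ran v → v ⊆ran u → R u y → R v y)
    (resp     : ∀ {u} → R u Respects _≈_)
    (total    : ∀ u → ∃[ y ] R u y)
    (fresh    : ∀ {u y} → R u y → ¬ y ∈ran u)
    where

    private
      -- `R u y` allows `y` as the next value when `u` enumerates the earlier ones; the choice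
      -- cannot see the order of that enumeration.
      choice = ac sequences Cantor R (λ (p , q) → resp-ran p q) resp total
      f = proj₁ choice

    -- upTo a enumerates the values at all ordinals b ≤ a, starting with the
    -- value at a, and before s those at all b < sup s.
    upTo   : Ord → ℕ → Point
    before : (ℕ → Ord) → ℕ → Point
    upTo zero    _       = const false
    upTo (sup s) zero    = Func.to f (before s)
    upTo (sup s) (suc n) = before s n
    before s n = upTo (s (proj₁ (unpair n))) (proj₂ (unpair n))

    value : Ord → Point
    value a = upTo a 0

    value-spec : ∀ s → R (before s) (value (sup s))
    value-spec s = proj₂ choice (before s)

    upTo-sound   : ∀ a n → ∃[ b ] b ≤ a × value b ≈ upTo a n
    before-sound : ∀ s n → ∃[ b ] b < sup s × value b ≈ before s n
    upTo-sound zero    n       = zero , tt , ≈-refl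
    upTo-sound (sup s) zero    = sup s , ≤-refl (sup s) , ≈-refl
    upTo-sound (sup s) (suc n) with b , p , e ← before-sound s n = b , <⇒≤ b (sup s) p , e
    before-sound s n with b , p , e ← upTo-sound (s (proj₁ (unpair n))) (proj₂ (unpair n)) =
      b , (proj₁ (unpair n) , p) , e

    -- Completeness at the terms `s j` is a hypothesis here, so that the induction below can supply
    -- it from its own smaller instances.
    before-complete′ : ∀ s → (∀ j {b} → b ≤ s j → value b ∈ran upTo (s j)) →
                       ∀ {b} → b < sup s → value b ∈ran before s
    before-complete′ s h (j , p) = ∈-⋃ran (upTo ∘ s) j (h j p)

    upTo-complete′ : ∀ a → Acc _<_ a → ∀ {b} → b ≤ a → value b ∈ran upTo a
    -- Trees for the same ordinal have the same earlier values, hence `before` sequences of equal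
    -- range, on which the choice function agrees.
    value-cong′    : ∀ a → Acc _<_ a → ∀ b → a ≤ b → b ≤ a → value a ≈ value b
    upTo-complete′ a       p       {b} b≤a with ≤-<-connex a b
    -- Here `a` and `b` are one ordinal, perhaps given by different trees.
    ... | inj₁ a≤b = 0 , value-cong′ a p b a≤b b≤a
    upTo-complete′ (sup s) (acc h) {b} b≤a | inj₂ b<a
      with n , e ← before-complete′ s (λ j → upTo-complete′ (s j) (h (j , ≤-refl (s j)))) b<a
      = suc n , e
    value-cong′ zero    p       zero    a≤b b≤a = ≈-refl
    value-cong′ zero    p       (sup t) a≤b b≤a = contradiction (b≤a 0) λ ()
    value-cong′ (sup s) p       zero    a≤b b≤a = contradiction (a≤b 0) λ ()
    value-cong′ (sup s) (acc h) (sup t) a≤b b≤a = Func.cong f {before s} {before t} (s⊆t , t⊆s)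
      where
      s⊆t : before s ⊆ran before t
      s⊆t n with c , c<s , e ← before-sound s n =
        ∈ran-resp (before t) e
          -- By `b≤a` each `t j` lies below `sup s`, so accessibility of `sup s` serves for both
          -- trees.
          (before-complete′ t (λ j → upTo-complete′ (t j) (h (b≤a j))) (<-≤-trans c (sup s) _ c<s a≤b))
      t⊆s : before t ⊆ran before s
      t⊆s n with c , c<t , e ← before-sound t n =
        ∈ran-resp (before s) e
          (before-complete′ s (λ j → upTo-complete′ (s j) (h (j , ≤-refl (s j))))
            (<-≤-trans c (sup t) _ c<t b≤a))

    upTo-complete : ∀ a {b} → b ≤ a → value b ∈ran upTo a
    upTo-complete a = upTo-complete′ a (<-wellFounded a)

    value-cong : ∀ a b → a ≤ b → b ≤ a → value a ≈ value b
    value-cong a b = value-cong′ a (<-wellFounded a) b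

    before-complete : ∀ s {b} → b < sup s → value b ∈ran before s
    before-complete s = before-complete′ s (λ j → upTo-complete (s j))

    value-fresh : ∀ a b → a < b → ¬ value a ≈ value b
    value-fresh a (sup t) a<b e =
      fresh (value-spec t) (∈ran-resp (before t) e (before-complete t a<b))

    value-≤ : ∀ a b → value a ≈ value b → a ≤ b
    value-≤ a b e with ≤-<-connex a b
    ... | inj₁ a≤b = a≤b
    ... | inj₂ b<a = contradiction (≈-sym e) (value-fresh b a b<a)

    ω₁-value : Func ω₁ Cantor
    ω₁-value = record
      { to   = value ∘ rank
      ; cong = λ {α} {β} i → value-cong (rank α) (rank β) (rank-mono i) (rank-mono {β} {α} (≅-sym {α} {β} i))
      }

    ω₁-value-injective : ∀ α β → value (rank α) ≈ value (rank β) → α ≅ β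
    ω₁-value-injective α β e =
      rank-injective α β (value-≤ (rank α) (rank β) e) (value-≤ (rank β) (rank α) (≈-sym e))

  -- For each term of a covering sequence pick an ordinal with that value, if there is one. The
  -- supremum `top` exceeds all of these, yet its own value is some term, so an earlier ordinal
  -- shares it.
  values-¬Small : (g : Ord → Point) → (∀ a b → a < b → ¬ g a ≈ g b) → ¬ Small (λ x → ∃[ a ] g a ≈ x)
  values-¬Small g g-fresh (u , cover) =
    g-fresh (pick em) top (proj₁ index , ≤-refl (pick em)) (≈-trans (pick-≈ em) (proj₂ index))
    where
    pick : ∀ {n} → Dec (∃[ a ] g a ≈ u n) → Ord
    pick (yes (a , _)) = a
    pick (no  _)       = zero
    top : Ord
    top = sup λ n → pick {n} em
    index : g top ∈ran u
    index = cover (top , ≈-refl)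
    pick-≈ : (d : Dec (∃[ a ] g a ≈ u (proj₁ index))) → g (pick d) ≈ u (proj₁ index)
    pick-≈ (yes (_ , e)) = e
    pick-≈ (no ¬p)       = contradiction (top , ≈-sym (proj₂ index)) ¬p

  ¬Small-⋃ : ∀ {A P : Pred Point 0ℓ} {Q : ℕ → Pred Point 0ℓ} → ¬ Small A →
             (∀ {x} → x ∈ A → x ∈ P ⊎ ∃[ n ] x ∈ Q n) → Small P → ∃[ n ] ¬ Small (Q n)
  ¬Small-⋃ {Q = Q} ¬small split smallP with ∀⊎∃¬ (λ n → Small (Q n))
  ... | inj₁ smallQ = contradiction (Small-⊆ split (Small-∪ smallP (Small-⋃ smallQ))) ¬small
  ... | inj₂ p      = p

  ω₁-injects : AxiomOfChoice 0ℓ → (X : Subset) → ¬ Small (member X) →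
               Σ[ f ∈ Func ω₁ Cantor ] (∀ α → Func.to f α ∈ member X) ×
                                       (∀ α β → Func.to f α ≈ Func.to f β → α ≅ β)
  ω₁-injects ac X ¬small = ω₁-value , (λ α → value∈X (rank α) (0 , tt)) , ω₁-value-injective
    where
    R : (ℕ → Point) → Point → Set
    R u y = y ∈ member X × ¬ y ∈ran u
    total : ∀ u → ∃[ y ] R u y
    total u = decidable-stable em λ none →
      ¬small (u , λ {x} x∈X → decidable-stable em λ x∉u → none (x , x∈X , x∉u))
    resp-ran : ∀ {u v y} → u ⊆ran v → v ⊆ran u → R u y → R v y
    resp-ran _ v⊆u (y∈X , y∉u) = y∈X , λ y∈v → y∉u (∈-⊆ran y∈v v⊆u)
    resp : ∀ {u} → R u Respects _≈_
    resp {u} y≈z (y∈X , y∉u) = respects X y≈z y∈X , λ z∈u → y∉u (∈ran-resp u (≈-sym y≈z) z∈u)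
    open Recursion ac R resp-ran resp total proj₂
    value∈X : ∀ a → zero < a → value a ∈ member X
    value∈X (sup s) _ = proj₁ (value-spec s)

-- A fresh real having a given sequence among its columns.

-- Column 0 diagonalizes against u, and column n + 1 is u n.
code : (ℕ → Point) → Point
code u k = entry (unpair k)
  where
  entry : ℕ × ℕ → _
  -- The negated bit is taken at `k`, the very position where `code u` and `u j` are to differ.
  entry (zero  , j) = not (u j k)
  entry (suc n , j) = u n j

code-fresh : ∀ u → ¬ code u ∈ran u
code-fresh u (j , e) with e′ ← e (pair 0 j) rewrite unpair-pair 0 j = not-¬ refl e′

code-column : ∀ u n → column (suc n) (code u) ≈ u n
code-column u n k rewrite unpair-pair (suc n) k = refl

-- The set `W` and the splitting of its uncountable subsets.

corollary11 : ExcludedMiddle 0ℓ → AxiomOfChoice 0ℓ → ∃[ W ] Grinzing W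
corollary11 em ac = W , ¬Small⇒Uncountable em W (values-¬Small em value value-fresh) , split
  where
  R : (ℕ → Point) → Point → Set
  R u y = ¬ y ∈ran u × (∀ n → ∃[ m ] column m y ≈ u n)
  resp-ran : ∀ {u v y} → u ⊆ran v → v ⊆ran u → R u y → R v y
  resp-ran u⊆v v⊆u (y∉u , cols) =
    (λ y∈v → y∉u (∈-⊆ran y∈v v⊆u)) ,
    λ n → let i , e = v⊆u n ; m , e′ = cols i in m , ≈-trans e′ e
  resp : ∀ {u} → R u Respects _≈_
  resp {u} y≈z (y∉u , cols) =
    (λ z∈u → y∉u (∈ran-resp u (≈-sym y≈z) z∈u)) ,
    λ n → let m , e = cols n in m , ≈-trans (column-cong m (≈-sym y≈z)) e
  total : ∀ u → ∃[ y ] R u y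
  total u = code u , code-fresh u , λ n → suc n , code-column u n
  open Recursion em ac R resp-ran resp total proj₁

  W : Subset
  W = record
    { member   = λ x → ∃[ a ] value a ≈ x
    ; respects = λ x≈y (a , e) → a , ≈-trans e x≈y
    }

  column-value : ∀ a b → a < b → ∃[ n ] column n (value b) ≈ value a
  column-value a (sup t) a<b =
    let i , e = before-complete t a<b ; m , e′ = proj₂ (value-spec t) i in m , ≈-trans e′ e

  module _ (Y : Subset) (Y⊆W : member Y ⊆ member W) (unc : Uncountable Y) where

    fibre : ℕ → Point → Subset
    fibre n x = record
      { member   = λ y → y ∈ member Y × column n y ≈ x
      ; respects = λ y≈z (y∈Y , e) → respects Y y≈z y∈Y , ≈-trans (column-cong n (≈-sym y≈z)) e
      }

    fibre-cong : ∀ n {x x′} → x ≈ x′ → member (fibre n x) ⊆ member (fibre n x′)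
    fibre-cong n e (y∈Y , p) = y∈Y , ≈-trans p e

    Y-¬Small : ¬ Small (member Y)
    Y-¬Small = Uncountable⇒¬Small em ac Y unc

    -- Points of `Y` arising at stages up to `a` are covered by `upTo a`; those from later stages
    -- have `x` as a column, so they lie in some fibre.
    large-fibre : ∀ {x} → x ∈ member W → ∃[ n ] ¬ Small (member (fibre n x))
    large-fibre {x} (a , a≈x) = ¬Small-⋃ em Y-¬Small cover (upTo a , id)
      where
      cover : ∀ {y} → y ∈ member Y → y ∈ran upTo a ⊎ ∃[ n ] y ∈ member (fibre n x)
      cover {y} y∈Y with b , b≈y ← Y⊆W y∈Y | ≤-<-connex em b a
      ... | inj₁ b≤a = inj₁ (∈ran-resp (upTo a) b≈y (upTo-complete a b≤a))
      ... | inj₂ a<b with n , e ← column-value a b a<b =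
        inj₂ (n , y∈Y , ≈-trans (column-cong n (≈-sym b≈y)) (≈-trans e a≈x))

    X : ℕ → Subset
    X n = record
      { member   = λ x → x ∈ member Y × ¬ Small (member (fibre n x))
      ; respects = λ x≈x′ (x∈Y , ¬small) → respects Y x≈x′ x∈Y ,
                     λ small → ¬small (Small-⊆ (fibre-cong n x≈x′) small)
      }

    large-X : ∃[ n ] ¬ Small (member (X n))
    large-X = ¬Small-⋃ em {P = λ _ → ⊥} Y-¬Small
      (λ x∈Y → let n , ¬small = large-fibre (Y⊆W x∈Y) in inj₂ (n , x∈Y , ¬small))
      ((λ _ → const false) , λ ())

    column-cl : ∀ n x {z} → z ∈ cl (fibre n x) → column n z ≈ x
    column-cl n x z∈cl k =
      -- Agreement below `suc (pair n k)` just includes the position of bit `k` of column `n`.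
      let y , (_ , e) , agree = z∈cl (suc (pair n k))
      in trans (sym (agree (pair n k) (n<1+n _))) (e k)

    split : Σ[ F ∈ Func ω₁ subsets ] let open Func F renaming (to to Y[_]) in
      (∀ α → member Y[ α ] ⊆ member Y × Uncountable Y[ α ]) ×
      (∀ α β → ¬ α ≅ β → ∀ {z} → z ∈ cl Y[ α ] × z ∈ cl Y[ β ] → ⊥)
    split with n , ¬small ← large-X with f , f∈X , f-injective ← ω₁-injects em ac (X n) ¬small =
      record
        { to   = λ α → fibre n (Func.to f α)
        ; cong = λ {α} {β} i → let e = Func.cong f {α} {β} i in
            fibre-cong n e , fibre-cong n (≈-sym e)
        } ,
      (λ α → proj₁ , ¬Small⇒Uncountable em (fibre n (Func.to f α)) (proj₂ (f∈X α))) ,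
      -- All pieces use the same `n`, so column `n` of a common closure point equals both `f α` and
      -- `f β`.
      λ α β α≇β (p , q) → α≇β (f-injective α β
        (≈-trans (≈-sym (column-cl n _ p)) (column-cl n _ q)))
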